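{- Let $G$ be a countable locally finite abelian group (written additively) for which $2G=\{2g:g\in G\}$ is finite, and let $G_\bullet=(G_i)_{i\ge1}$ be any filtration of $G$ by finite subgroups. For every $A\subseteq G$ there exists $m\in\mathbb Z_{\ge0}\cup\{\infty\}$ such that $$\frac{2^{ -m}}{|2G|}\le\underline d_{G_\bullet}\bigl(\mathcal P(A)\bigr)\le\overline d_{G_\bullet}\bigl(\mathcal P(A)\bigr)\le2^{ -m},$$ where $2^{ -\infty}:=0$. In particular, $$\overline d_{G_\bullet}\bigl(\mathcal P(A)\bigr)>\tfrac12\quad\Longrightarrow\quad\underline d_{G_\bullet}\bigl(\mathcal P(A)\bigr)\ge\frac1{|2G|}.$$
   Context: An abelian group is locally finite if every finitely generated subgroup is finite. A filtration of $G$ by finite subgroups is a chain $G_1\le G_2\le\cdots$ of finite subgroups with $\bigcup_{i\ge1}G_i=G$. For $A\subseteq G$, $\mathcal P(A):=\{\sum_{a\in F}a : F\subseteq A,\ |F|<\infty\}$ is the set of finite subset sums, including the empty sum $0$. For $S\subseteq G$: $d_i^{G_\bullet}(S):=|S\cap G_i|/|G_i|$, $\underline d_{G_\bullet}(S):=\liminf_{i\to\infty}d_i^{G_\bullet}(S)$, $\overline d_{G_\bullet}(S):=\limsup_{i\to\infty}d_i^{G_\bullet}(S)$. -}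

module Defs where

open import Algebra.Bundles using (AbelianGroup)
open import Axiom.ExcludedMiddle using (ExcludedMiddle)
open import Data.Integer.Base using (+_)
open import Data.List.Base using (List; _∷_; []; foldr; filter; length)
open import Data.List.Relation.Unary.All using (All)
open import Data.List.Relation.Unary.Any using (here; there)
import Data.List.Membership.Setoid as Membership
import Data.List.Relation.Unary.Unique.Setoid as UniqueSetoid
open import Data.Nat.Base as ℕ using (ℕ; suc; NonZero)
open import Data.Nat.Properties using (m^n≢0)
open import Data.Product.Base using (∃; _×_; _,_)
open import Data.Rational.Base as ℚ using (ℚ; 0ℚ; _/_)
open import Data.Rational.Properties using (<-trans; <-dense)
open import Function.Bundles using (Injection)
open import Level using (Level; _⊔_; Setω; 0ℓ) renaming (suc to lsuc)
open import Relation.Binary.Definitions using (_Respects_)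
import Relation.Binary.PropositionalEquality.Properties as ≡
open import Relation.Nullary.Construct.Add.Supremum using (_⁺; ⊤⁺; [_])
open import Relation.Nullary.Negation.Core using (¬_)
open import Relation.Unary using (Pred; _⊆_)

private
  variable
    c ℓ p s : Level

-- The results are about classical mathematics; they take this as an explicit
-- hypothesis.
Classical : Setω
Classical = ∀ {a} → ExcludedMiddle a

------------------------------------------------------------------------
-- Extended reals

-- Lower Dedekind cuts of ℚ. The empty cut is -∞ and the full cut is +∞, so
-- that, classically, this is the complete lattice [-∞, +∞].
record ℝ∞ : Set₁ where
  field
    lower      : Pred ℚ 0ℓ
    downClosed : ∀ {q r} → q ℚ.< r → lower r → lower q
    rounded    : ∀ {q} → lower q → ∃ λ r → q ℚ.< r × lower r

open ℝ∞

infix 4 _≤ʳ_ _<ʳ_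

_≤ʳ_ : ℝ∞ → ℝ∞ → Set
x ≤ʳ y = lower x ⊆ lower y

_<ʳ_ : ℝ∞ → ℝ∞ → Set
x <ʳ y = ∃ λ q → ¬ lower x q × lower y q

fromℚ : ℚ → ℝ∞
fromℚ x .lower q        = q ℚ.< x
fromℚ x .downClosed     = <-trans
fromℚ x .rounded q<x    = let r , q<r , r<x = <-dense q<x in r , q<r , r<x

sup : (ℕ → ℝ∞) → ℝ∞
sup x .lower q                = ∃ λ n → lower (x n) q
sup x .downClosed q<r (n , l) = n , downClosed (x n) q<r l
sup x .rounded (n , l)        = let r , q<r , l′ = rounded (x n) l in r , q<r , n , l′

-- The intersection of infinitely many cuts need not be rounded, hence the r.
inf : (ℕ → ℝ∞) → ℝ∞
inf x .lower q                      = ∃ λ r → q ℚ.< r × (∀ n → lower (x n) r)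
inf x .downClosed q<q′ (r , q′<r , l) = r , <-trans q<q′ q′<r , l
inf x .rounded (r , q<r , l)        = let t , q<t , t<r = <-dense q<r in t , q<t , r , t<r , l

liminf limsup : (ℕ → ℝ∞) → ℝ∞
liminf x = sup λ n → inf λ i → x (n ℕ.+ i)
limsup x = inf λ n → sup λ i → x (n ℕ.+ i)

-- 2^(-m) for m ∈ ℕ ∪ {∞}.
2^- : ℕ ⁺ → ℚ
2^- [ m ] = (+ 1 / (2 ℕ.^ m)) {{m^n≢0 2 m}}
2^- ⊤⁺    = 0ℚ

------------------------------------------------------------------------
-- Subsets of an abelian group

module _ (G : AbelianGroup c ℓ) where

  open AbelianGroup G renaming (_∙_ to _+_; ε to 0#; _⁻¹ to -_)
  open Membership setoid using (_∈_)
  open UniqueSetoid setoid using (Unique)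

  Countable : Set (c ⊔ ℓ)
  Countable = Injection setoid (≡.setoid ℕ)

  record Finite (P : Pred Carrier p) : Set (c ⊔ ℓ ⊔ p) where
    field
      elements : List Carrier
      unique   : Unique elements
      sound    : All P elements
      complete : ∀ {x} → P x → x ∈ elements

  record IsSubgroup (P : Pred Carrier p) : Set (c ⊔ ℓ ⊔ p) where
    field
      respects : P Respects _≈_
      0-closed : P 0#
      +-closed : ∀ {x y} → P x → P y → P (x + y)
      --closed : ∀ {x} → P x → P (- x)

  -- The subgroup generated by the elements of a list.
  data Generated (xs : List Carrier) : Pred Carrier (c ⊔ ℓ) where
    gen  : ∀ {x} → x ∈ xs → Generated xs x
    zero : Generated xs 0#
    add  : ∀ {x y} → Generated xs x → Generated xs y → Generated xs (x + y)
    neg  : ∀ {x} → Generated xs x → Generated xs (- x)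
    resp : ∀ {x y} → x ≈ y → Generated xs x → Generated xs y

  LocallyFinite : Set (c ⊔ ℓ)
  LocallyFinite = ∀ xs → Finite (Generated xs)

  2G : Pred Carrier (c ⊔ ℓ)
  2G x = ∃ λ g → x ≈ g + g

  -- The set of sums of finite subsets F of A; F is a list of pairwise distinct
  -- elements.
  SubsetSums : Pred Carrier p → Pred Carrier (c ⊔ ℓ ⊔ p)
  SubsetSums A x = ∃ λ F → Unique F × All A F × x ≈ foldr _+_ 0# F

  -- Indexed from 0 rather than from 1.
  record Filtration (s : Level) : Set (c ⊔ ℓ ⊔ lsuc s) where
    field
      subgroup   : ℕ → Pred Carrier s
      isSubgroup : ∀ i → IsSubgroup (subgroup i)
      finite     : ∀ i → Finite (subgroup i)
      ascending  : ∀ i → subgroup i ⊆ subgroup (suc i)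
      exhaustive : ∀ x → ∃ λ i → subgroup i x

module _ {G : AbelianGroup c ℓ} where

  open AbelianGroup G renaming (_∙_ to _+_; ε to 0#; _⁻¹ to -_)

  card : {P : Pred Carrier p} → Finite G P → ℕ
  card P-finite = length (Finite.elements P-finite)

  card-nonZero : {P : Pred Carrier p} (P-finite : Finite G P) → ∃ P → NonZero (card P-finite)
  card-nonZero record { elements = [] ; complete = complete } (_ , Px) with () ← complete Px
  card-nonZero record { elements = _ ∷ _ } _ = _

  reciprocalCard2G : Finite G (2G G) → ℚ
  reciprocalCard2G 2G-finite =
    (+ 1 / card 2G-finite) {{card-nonZero 2G-finite (0# , 0# , sym (identityˡ 0#))}}

  -- ∣S ∩ P∣, for S closed under _≈_: the number of listed elements of P that
  -- lie in S.
  card-∩ : Classical → Pred Carrier s → {P : Pred Carrier p} → Finite G P → ℕ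
  card-∩ em S P-finite = length (filter (λ x → em {P = S x}) (Finite.elements P-finite))

  module _ (em : Classical) (G• : Filtration G s) where

    open Filtration G•

    density : Pred Carrier p → ℕ → ℚ
    density S i =
      (+ card-∩ em S (finite i) / card (finite i))
        {{card-nonZero (finite i) (0# , IsSubgroup.0-closed (isSubgroup i))}}

    lowerDensity upperDensity : Pred Carrier p → ℝ∞
    lowerDensity S = liminf λ i → fromℚ (density S i)
    upperDensity S = limsup λ i → fromℚ (density S i)

{-# OPTIONS --safe #-}
-- P(A) + 2G is a subgroup K: the sum of two subset sums differs from the sum
-- over the symmetric difference by twice the sum over the intersection. Since
-- 2G ⊆ K, adjoining to K one element outside it doubles its trace on every
-- large G_i. Either n such steps exhaust G, and then |K ∩ G_i| = 2⁻ⁿ|G_i| for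
-- large i and m = n, or they never do, and then K has density 0 and m = ∞.
-- Finally |P(A) ∩ G_i| ≤ |K ∩ G_i| ≤ |2G| |P(A) ∩ G_i| as soon as 2G ⊆ G_i.
module Submission where

open import Defs
open import Algebra.Bundles using (AbelianGroup)
import Algebra.Properties.AbelianGroup as AbelianGroupProperties
import Algebra.Properties.CommutativeSemigroup as CommutativeSemigroupProperties
open import Data.Integer.Base as ℤ using (+_; +[1+_])
import Data.Integer.Properties as ℤ
open import Data.List.Base using (List; []; _∷_; _++_; foldr; map; length; filter; cartesianProductWith)
import Data.List.Membership.Setoid as Membership
import Data.List.Membership.Setoid.Properties as ∈ₚ
open import Data.List.Properties using (length-++; length-map)
import Data.List.Relation.Binary.Permutation.Setoid as Permutation
import Data.List.Relation.Binary.Permutation.Setoid.Properties as PermutationProperties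
open import Data.List.Relation.Unary.All as All using (All; []; _∷_)
import Data.List.Relation.Unary.All.Properties as All
open import Data.List.Relation.Unary.AllPairs using ([]; _∷_)
open import Data.List.Relation.Unary.Any using (here; there)
import Data.List.Relation.Unary.Unique.Setoid as UniqueSetoid
import Data.List.Relation.Unary.Unique.Setoid.Properties as Unique
open import Data.Nat.Base as ℕ using (ℕ; zero; suc; NonZero)
import Data.Nat.Properties as ℕ
open import Data.Product.Base using (∃; ∃₂; _×_; _,_; proj₂)
open import Data.Rational.Base as ℚ using (ℚ; _*_; ½; 0ℚ; _/_; mkℚ)
import Data.Rational.Properties as ℚ
import Data.Rational.Unnormalised.Base as ℚᵘ
import Data.Rational.Unnormalised.Properties as ℚᵘ
open import Data.Sum.Base using (_⊎_; inj₁; inj₂; [_,_]′)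
open import Function.Base using (_∘_)
open import Level using (Level; _⊔_) renaming (suc to lsuc)
open import Relation.Binary.Bundles using (Setoid)
open import Relation.Binary.Definitions using (_Respects_)
open import Relation.Binary.PropositionalEquality.Core as ≡ using (_≡_; refl; cong; subst)
import Relation.Binary.Reasoning.Setoid as ≈-Reasoning
open import Relation.Nullary using (¬_; yes; no; contradiction)
open import Relation.Nullary.Construct.Add.Supremum using (_⁺; ⊤⁺) renaming ([_] to fin)
open import Relation.Unary using (Pred; _⊆_; _∩_)

private
  variable
    c ℓ p q s : Level

Eventually : Pred ℕ p → Set p
Eventually P = ∃ λ N → ∀ {i} → N ℕ.≤ i → P i

eventually-∩ : {P : Pred ℕ p} {Q : Pred ℕ q} → Eventually P → Eventually Q → Eventually (P ∩ Q)
eventually-∩ (M , f) (N , g) = M ℕ.⊔ N , λ le →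
  f (ℕ.≤-trans (ℕ.m≤m⊔n M N) le) , g (ℕ.≤-trans (ℕ.m≤n⊔m M N) le)

eventually-map : {P : Pred ℕ p} {Q : Pred ℕ q} → P ⊆ Q → Eventually P → Eventually Q
eventually-map f (N , g) = N , λ le → f (g le)

liminf≤limsup : ∀ x → liminf x ≤ʳ limsup x
liminf≤limsup x (n , r , q<r , r<x) = r , q<r , λ k →
  n , subst (λ i → ℝ∞.lower (x i) r) (ℕ.+-comm n k) (r<x k)

liminf-≥ : ∀ {r} {d : ℕ → ℚ} → Eventually (λ i → r ℚ.≤ d i) → fromℚ r ≤ʳ liminf (λ i → fromℚ (d i))
liminf-≥ (N , r≤d) q<r = let t , q<t , t<r = ℚ.<-dense q<r in
  N , t , q<t , λ i → ℚ.<-≤-trans t<r (r≤d (ℕ.m≤m+n N i))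

limsup-< : ∀ {r q} {d : ℕ → ℚ} → Eventually (λ i → d i ℚ.≤ r) →
           (∀ n → ℝ∞.lower (sup λ i → fromℚ (d (n ℕ.+ i))) q) → q ℚ.< r
limsup-< (N , d≤r) q<d = let i , q<di = q<d N in ℚ.<-≤-trans q<di (d≤r (ℕ.m≤m+n N i))

limsup-≤ : ∀ {r} {d : ℕ → ℚ} → Eventually (λ i → d i ℚ.≤ r) → limsup (λ i → fromℚ (d i)) ≤ʳ fromℚ r
limsup-≤ ev (_ , q<t , t<d) = ℚ.<-trans q<t (limsup-< ev t<d)

/-mono-≤ : ∀ {a b c d} .{{_ : NonZero b}} .{{_ : NonZero d}} →
           a ℕ.* d ℕ.≤ c ℕ.* b → + a / b ℚ.≤ + c / d
/-mono-≤ {a} {b@(suc _)} {c} {d@(suc _)} le = ℚ.toℚᵘ-cancel-≤ (begin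
  ℚ.toℚᵘ (+ a / b)  ≃⟨ ℚ.toℚᵘ-fromℚᵘ (+ a ℚᵘ./ b) ⟩
  + a ℚᵘ./ b        ≤⟨ ℚᵘ.*≤* (≡.subst₂ ℤ._≤_ (ℤ.pos-* a d) (ℤ.pos-* c b) (ℤ.+≤+ le)) ⟩
  + c ℚᵘ./ d        ≃⟨ ℚ.toℚᵘ-fromℚᵘ (+ c ℚᵘ./ d) ⟨
  ℚ.toℚᵘ (+ c / d)  ∎)
  where open ℚᵘ.≤-Reasoning

1/-* : ∀ a b .{{_ : NonZero a}} .{{_ : NonZero b}} →
       (+ 1 / a) * (+ 1 / b) ≡ (+ 1 / (a ℕ.* b)) {{ℕ.m*n≢0 a b}}
1/-* a@(suc _) b@(suc _) = ℚ.toℚᵘ-injective (begin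
  ℚ.toℚᵘ ((+ 1 / a) * (+ 1 / b))              ≈⟨ ℚ.toℚᵘ-homo-* (+ 1 / a) (+ 1 / b) ⟩
  ℚ.toℚᵘ (+ 1 / a) ℚᵘ.* ℚ.toℚᵘ (+ 1 / b)      ≈⟨ ℚᵘ.*-cong (ℚ.toℚᵘ-fromℚᵘ (+ 1 ℚᵘ./ a)) (ℚ.toℚᵘ-fromℚᵘ (+ 1 ℚᵘ./ b)) ⟩
  (+ 1 ℚᵘ./ a) ℚᵘ.* (+ 1 ℚᵘ./ b)              ≈⟨ ℚ.toℚᵘ-fromℚᵘ (+ 1 ℚᵘ./ (a ℕ.* b)) ⟨
  ℚ.toℚᵘ (+ 1 / (a ℕ.* b))                    ∎)
  where open ≈-Reasoning ℚᵘ.≃-setoid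

n≤2^n : ∀ n → n ℕ.≤ 2 ℕ.^ n
n≤2^n zero    = ℕ.z≤n
n≤2^n (suc n) = ℕ.+-mono-≤ (ℕ.m^n>0 2 n) (ℕ.≤-trans (n≤2^n n) (ℕ.m≤m+n _ 0))

2^-≤ : ∀ {q} → 0ℚ ℚ.< q → ∃ λ n → 2^- (fin n) ℚ.≤ q
2^-≤ {q@(mkℚ +[1+ a ] b-1 _)} _ = b , (begin
  2^- (fin b)      ≤⟨ /-mono-≤ {1} {2 ℕ.^ b} {suc a} {b} {{ℕ.m^n≢0 2 b}} b≤ ⟩
  +[1+ a ] / b     ≡⟨ ℚ.↥p/↧p≡p q ⟩
  q                ∎)
  where
  open ℚ.≤-Reasoning
  b = suc b-1
  b≤ : 1 ℕ.* b ℕ.≤ suc a ℕ.* 2 ℕ.^ b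
  b≤ = ℕ.*-mono-≤ (ℕ.s≤s (ℕ.z≤n {a})) (n≤2^n b)
2^-≤ {mkℚ (+ 0) _ _} (ℚ.*<* (ℤ.+<+ ()))
2^-≤ {mkℚ (ℤ.-[1+ _ ]) _ _} (ℚ.*<* ())

limsup-≤0 : ∀ {d : ℕ → ℚ} → (∀ n → Eventually (λ i → d i ℚ.≤ 2^- (fin n))) →
            limsup (λ i → fromℚ (d i)) ≤ʳ fromℚ 0ℚ
limsup-≤0 ev {q} (t , q<t , t<d) with 0ℚ ℚ.<? t
... | no  t≤0 = ℚ.<-≤-trans q<t (ℚ.≮⇒≥ t≤0)
... | yes 0<t = let n , le = 2^-≤ 0<t in
  contradiction (ℚ.<-≤-trans (limsup-< (ev n) t<d) le) (ℚ.<-irrefl refl)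

module _ (S : Setoid c ℓ) where

  open Setoid S renaming (refl to ≈-refl)
  open Membership S using (_∈_)
  open UniqueSetoid S using (Unique)
  open Permutation S using (_↭_; ↭-trans; ↭-reflexive-≋)
  open PermutationProperties S using (shift; ∈-resp-↭; xs↭ys⇒|xs|≡|ys|)

  ∈-split : ∀ {x xs} → x ∈ xs → ∃ λ ys → xs ↭ x ∷ ys
  ∈-split x∈xs with ys , zs , _ , x≈w , xs≋ ← ∈ₚ.∈-∃++ S x∈xs =
    ys ++ zs , ↭-trans (↭-reflexive-≋ xs≋) (shift (sym x≈w) ys zs)

  unique-⊆⇒length≤ : ∀ {xs ys} → Unique xs → (∀ {x} → x ∈ xs → x ∈ ys) → length xs ℕ.≤ length ys
  unique-⊆⇒length≤ {[]} _ _ = ℕ.z≤n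
  unique-⊆⇒length≤ {x ∷ xs} (x∉xs ∷ xs!) sub with zs , ys↭ ← ∈-split (sub (here ≈-refl)) =
    subst (suc (length xs) ℕ.≤_) (≡.sym (xs↭ys⇒|xs|≡|ys| ys↭))
      (ℕ.s≤s (unique-⊆⇒length≤ xs! tail))
    where
    tail : ∀ {y} → y ∈ xs → y ∈ zs
    tail y∈xs with ∈-resp-↭ ys↭ (sub (there y∈xs))
    ... | there y∈zs = y∈zs
    ... | here y≈x   = contradiction (∈ₚ.∈-resp-≈ S y≈x y∈xs) (All.All¬⇒¬Any x∉xs)

length-cartesianProductWith : ∀ {a b d} {A : Set a} {B : Set b} {D : Set d} (f : A → B → D) xs ys →
  length (cartesianProductWith f xs ys) ≡ length xs ℕ.* length ys
length-cartesianProductWith f []       ys = refl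
length-cartesianProductWith f (x ∷ xs) ys = ≡.trans (length-++ (map (f x) ys))
  (≡.cong₂ ℕ._+_ (length-map (f x) ys) (length-cartesianProductWith f xs ys))

module _ (em : Classical) (G : AbelianGroup c ℓ) where

  open AbelianGroup G hiding (_-_) renaming (_∙_ to _+_; ε to 0#; _⁻¹ to -_; refl to ≈-refl)
  open AbelianGroupProperties G using (∙-cancelʳ; //-rightDividesˡ; //-rightDividesʳ)
  open CommutativeSemigroupProperties commutativeSemigroup using (interchange; xy∙z≈xz∙y)
  open Membership setoid using (_∈_)
  open UniqueSetoid setoid using (Unique)
  open Finite

  card-mono : {P : Pred Carrier p} {Q : Pred Carrier q} (P-finite : Finite G P) (Q-finite : Finite G Q) →
              P Respects _≈_ → P ⊆ Q → card P-finite ℕ.≤ card Q-finite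
  card-mono P-finite Q-finite P-resp P⊆Q = unique-⊆⇒length≤ setoid (unique P-finite)
    λ x∈ → complete Q-finite (P⊆Q (All.lookupₛ setoid P-resp (sound P-finite) x∈))

  card-sumset : {P : Pred Carrier p} {Q : Pred Carrier q} {R : Pred Carrier s}
                (P-finite : Finite G P) (Q-finite : Finite G Q) (R-finite : Finite G R) →
                R Respects _≈_ → (∀ {x} → R x → ∃₂ λ y z → P y × Q z × x ≈ y + z) →
                card R-finite ℕ.≤ card P-finite ℕ.* card Q-finite
  card-sumset P-finite Q-finite R-finite R-resp R⊆P+Q =
    subst (card R-finite ℕ.≤_) (length-cartesianProductWith _+_ (elements P-finite) (elements Q-finite))
      (unique-⊆⇒length≤ setoid (unique R-finite) λ x∈ →
        let y , z , Py , Qz , x≈y+z = R⊆P+Q (All.lookupₛ setoid R-resp (sound R-finite) x∈) in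
        ∈ₚ.∈-resp-≈ setoid (sym x≈y+z)
          (∈ₚ.∈-cartesianProductWith⁺ setoid setoid setoid ∙-cong
            (complete P-finite Py) (complete Q-finite Qz)))

  ∩-finite : {S : Pred Carrier s} {P : Pred Carrier p} → S Respects _≈_ → Finite G P → Finite G (S ∩ P)
  ∩-finite {S = S} S-resp P-finite = record
    { elements = filter S? (elements P-finite)
    ; unique   = Unique.filter⁺ setoid S? (unique P-finite)
    ; sound    = All.zip (All.all-filter S? (elements P-finite) , All.filter⁺ S? (sound P-finite))
    ; complete = λ (Sx , Px) → ∈ₚ.∈-filter⁺ setoid S? S-resp (complete P-finite Px) Sx
    }
    where S? = λ x → em {P = S x}

  -- L ∪ (L - a), which is L ∪ (L + a) for the subgroups L ⊇ 2G used here.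
  adjoin : Carrier → Pred Carrier p → Pred Carrier p
  adjoin a L x = L x ⊎ L (x + a)

  adjoin-finite : {L : Pred Carrier p} (a : Carrier) → L Respects _≈_ → (∀ {x} → L x → ¬ L (x + a)) →
                  Finite G L → Finite G (adjoin a L)
  adjoin-finite {L = L} a L-resp disjoint L-finite = record
    { elements = xs ++ map (_+ - a) xs
    ; unique   = Unique.++⁺ setoid (unique L-finite)
        (Unique.map⁺ setoid setoid (λ {x} {y} → ∙-cancelʳ (- a) x y) (unique L-finite))
        λ (v∈xs , v∈map) → let y , y∈xs , v≈y-a = ∈ₚ.∈-map⁻ setoid setoid v∈map in
          disjoint (inL v∈xs) (L-resp (sym (trans (∙-congʳ v≈y-a) (//-rightDividesˡ a y))) (inL y∈xs))
    ; sound    = All.++⁺ (All.map inj₁ (sound L-finite))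
        (All.map⁺ (All.map (λ {x} Lx → inj₂ (L-resp (sym (//-rightDividesˡ a x)) Lx)) (sound L-finite)))
    ; complete = λ where
        (inj₁ Lx)   → ∈ₚ.∈-++⁺ˡ setoid (complete L-finite Lx)
        (inj₂ Lx+a) → ∈ₚ.∈-++⁺ʳ setoid xs (∈ₚ.∈-resp-≈ setoid (//-rightDividesʳ a _)
          (∈ₚ.∈-map⁺ setoid setoid ∙-congʳ (complete L-finite Lx+a)))
    }
    where
    xs = elements L-finite
    inL : ∀ {x} → x ∈ xs → L x
    inL = All.lookupₛ setoid L-resp (sound L-finite)

  card-adjoin : {L : Pred Carrier p} (a : Carrier) (L-resp : L Respects _≈_) (disjoint : ∀ {x} → L x → ¬ L (x + a)) →
                (L-finite : Finite G L) → card (adjoin-finite a L-resp disjoint L-finite) ≡ 2 ℕ.* card L-finite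
  card-adjoin a L-resp disjoint L-finite = ≡.trans (length-++ (elements L-finite))
    (cong (card L-finite ℕ.+_) (≡.trans (length-map (_+ - a) (elements L-finite)) (≡.sym (ℕ.+-identityʳ _))))

  module _ {L : Pred Carrier p} (L-subgroup : IsSubgroup G L) (2G⊆L : 2G G ⊆ L) where

    open IsSubgroup L-subgroup

    -- In Defs the would-be field --closed of IsSubgroup is lexed as a comment, so
    -- closure under negation is derived: -x = x + 2(-x).
    negation-closed : ∀ {x} → L x → L (- x)
    negation-closed {x} Lx = respects
      (trans (sym (assoc x (- x) (- x))) (trans (∙-congʳ (inverseʳ x)) (identityˡ _)))
      (+-closed Lx (2G⊆L (- x , ≈-refl)))

    +-cancelʳ-∈ : ∀ {x y} → L y → L (x + y) → L x
    +-cancelʳ-∈ {x} {y} Ly Lx+y = respects (//-rightDividesʳ y x) (+-closed Lx+y (negation-closed Ly))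

    +-cancelˡ-∈ : ∀ {x y} → L x → L (x + y) → L y
    +-cancelˡ-∈ {x} {y} Lx Lx+y = +-cancelʳ-∈ Lx (respects (comm x y) Lx+y)

    adjoin-isSubgroup : ∀ a → IsSubgroup G (adjoin a L)
    adjoin-isSubgroup a = record
      { respects = λ where
          x≈y (inj₁ Lx)   → inj₁ (respects x≈y Lx)
          x≈y (inj₂ Lx+a) → inj₂ (respects (∙-congʳ x≈y) Lx+a)
      ; 0-closed = inj₁ 0-closed
      ; +-closed = λ where
          (inj₁ Lx)   (inj₁ Ly)   → inj₁ (+-closed Lx Ly)
          (inj₁ Lx)   (inj₂ Ly+a) → inj₂ (respects (sym (assoc _ _ _)) (+-closed Lx Ly+a))
          (inj₂ Lx+a) (inj₁ Ly)   → inj₂ (respects (xy∙z≈xz∙y _ _ _) (+-closed Lx+a Ly))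
          (inj₂ Lx+a) (inj₂ Ly+a) → inj₁ (+-cancelʳ-∈ La+a (respects (interchange _ _ _ _) (+-closed Lx+a Ly+a)))
      }
      where
      La+a : L (a + a)
      La+a = 2G⊆L (a , ≈-refl)

  data Tower (K : Pred Carrier p) : ℕ → Pred Carrier p → Set (c ⊔ ℓ ⊔ lsuc p) where
    base : Tower K 0 K
    step : ∀ {n L} a → ¬ L a → Tower K n L → Tower K (suc n) (adjoin a L)

  tower-2G : ∀ {K : Pred Carrier p} {n L} → 2G G ⊆ K → Tower K n L → 2G G ⊆ L
  tower-2G 2G⊆K base         = 2G⊆K
  tower-2G 2G⊆K (step a _ T) = inj₁ ∘ tower-2G 2G⊆K T

  tower-isSubgroup : ∀ {K : Pred Carrier p} {n L} → IsSubgroup G K → 2G G ⊆ K → Tower K n L → IsSubgroup G L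
  tower-isSubgroup K-sub 2G⊆K base         = K-sub
  tower-isSubgroup K-sub 2G⊆K (step a _ T) =
    adjoin-isSubgroup (tower-isSubgroup K-sub 2G⊆K T) (tower-2G 2G⊆K T) a

  tower-exhaustive-or-unbounded : (K : Pred Carrier p) →
    (∃₂ λ n L → Tower K n L × (∀ x → L x)) ⊎ (∀ n → ∃ λ L → Tower K n L)
  tower-exhaustive-or-unbounded K with em {P = ∃₂ λ n L → Tower K n L × (∀ x → L x)}
  ... | yes full = inj₁ full
  ... | no ¬full = inj₂ grow
    where
    grow : ∀ n → ∃ λ L → Tower K n L
    grow zero = K , base
    grow (suc n) with L , T ← grow n with em {P = ∃ λ a → ¬ L a}
    ... | yes (a , ¬La) = adjoin a L , step a ¬La T
    ... | no ¬∃ = contradiction (n , L , T , full) ¬full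
      where
      full : ∀ x → L x
      full x with em {P = L x}
      ... | yes Lx = Lx
      ... | no ¬Lx = contradiction (x , ¬Lx) ¬∃

  module _ (A : Pred Carrier p) (A-resp : A Respects _≈_) where

    open PermutationProperties setoid using (All-resp-↭; Unique-resp-↭; foldr-commMonoid)

    sum : List Carrier → Carrier
    sum = foldr _+_ 0#

    subsetSums-resp : SubsetSums G A Respects _≈_
    subsetSums-resp x≈y (F , F! , AF , x≈) = F , F! , AF , trans (sym x≈y) x≈

    SubsetSums+2G : Pred Carrier (c ⊔ ℓ ⊔ p)
    SubsetSums+2G x = ∃₂ λ y t → SubsetSums G A y × 2G G t × x ≈ y + t

    subsetSums⊆ : SubsetSums G A ⊆ SubsetSums+2G
    subsetSums⊆ Px = _ , 0# , Px , (0# , sym (identityˡ 0#)) , sym (identityʳ _)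

    K-resp : SubsetSums+2G Respects _≈_
    K-resp x≈y (z , t , Pz , 2Gt , x≈) = z , t , Pz , 2Gt , trans (sym x≈y) x≈

    2G-+-closed : ∀ {x y} → 2G G x → 2G G y → 2G G (x + y)
    2G-+-closed (g , x≈) (h , y≈) = g + h , trans (∙-cong x≈ y≈) (interchange _ _ _ _)

    K-+2G : ∀ {x t} → SubsetSums+2G x → 2G G t → SubsetSums+2G (x + t)
    K-+2G (y , u , Py , 2Gu , x≈) 2Gt = y , _ , Py , 2G-+-closed 2Gu 2Gt , trans (∙-congʳ x≈) (assoc _ _ _)

    -- If a already occurs in F it is removed: ΣF + a = Σ(F ∖ {a}) + 2a.
    subsetSums-absorb : ∀ {a x} → A a → SubsetSums G A x → SubsetSums+2G (a + x)
    subsetSums-absorb {a} {x} Aa (F , F! , AF , x≈) with em {P = a ∈ F}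
    ... | no a∉F = subsetSums⊆ (a ∷ F , All.¬Any⇒All¬ F a∉F ∷ F! , Aa ∷ AF , ∙-congˡ x≈)
    ... | yes a∈F with F′ , F↭ ← ∈-split setoid a∈F
                  with _ ∷ F′! ← Unique-resp-↭ F↭ F! | _ ∷ AF′ ← All-resp-↭ A-resp F↭ AF =
      sum F′ , a + a , (F′ , F′! , AF′ , ≈-refl) , (a , ≈-refl) , (begin
        a + x              ≈⟨ ∙-congˡ (trans x≈ (foldr-commMonoid isCommutativeMonoid F↭)) ⟩
        a + (a + sum F′)   ≈⟨ assoc _ _ _ ⟨
        (a + a) + sum F′   ≈⟨ comm _ _ ⟩
        sum F′ + (a + a)   ∎)
      where open ≈-Reasoning setoid

    K-absorb : ∀ {F x} → All A F → SubsetSums+2G x → SubsetSums+2G (sum F + x)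
    K-absorb []        Kx = K-resp (sym (identityˡ _)) Kx
    K-absorb (Aa ∷ AF) Kx with y , t , Py , 2Gt , x≈ ← K-absorb AF Kx =
      K-resp (trans (assoc _ _ _) (trans (∙-congˡ (sym x≈)) (sym (assoc _ _ _))))
        (K-+2G (subsetSums-absorb Aa Py) 2Gt)

    K-isSubgroup : IsSubgroup G SubsetSums+2G
    K-isSubgroup = record
      { respects = K-resp
      ; 0-closed = subsetSums⊆ ([] , [] , [] , ≈-refl)
      ; +-closed = λ where
          (y , t , (F , _ , AF , y≈) , 2Gt , x≈) Kz →
            K-resp (trans (xy∙z≈xz∙y _ _ _) (∙-congʳ (sym (trans x≈ (∙-congʳ y≈)))))
              (K-+2G (K-absorb AF Kz) 2Gt)
      }

    2G⊆K : 2G G ⊆ SubsetSums+2G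
    2G⊆K 2Gx = K-resp (identityˡ _) (K-+2G (IsSubgroup.0-closed K-isSubgroup) 2Gx)

  module _ (G• : Filtration G s) where

    open Filtration G•

    ∣_∩G_∣ : Pred Carrier p → ℕ → ℕ
    ∣ S ∩G i ∣ = card-∩ em S (finite i)

    subgroup-mono : ∀ {i j} → i ℕ.≤ j → subgroup i ⊆ subgroup j
    subgroup-mono i≤j = go (ℕ.≤⇒≤′ i≤j)
      where
      go : ∀ {i j} → i ℕ.≤′ j → subgroup i ⊆ subgroup j
      go (ℕ.≤′-reflexive refl) = λ Gx → Gx
      go (ℕ.≤′-step i≤j)       = ascending _ ∘ go i≤j

    eventually-∈ : ∀ x → Eventually (λ i → subgroup i x)
    eventually-∈ x = let N , Gx = exhaustive x in N , λ N≤i → subgroup-mono N≤i Gx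

    eventually-All : ∀ xs → Eventually (λ i → All (subgroup i) xs)
    eventually-All []       = 0 , λ _ → []
    eventually-All (x ∷ xs) = eventually-map (λ (Gx , Gxs) → Gx ∷ Gxs)
      (eventually-∩ (eventually-∈ x) (eventually-All xs))

    eventually-⊇ : {P : Pred Carrier p} → Finite G P → Eventually (λ i → P ⊆ subgroup i)
    eventually-⊇ P-finite = eventually-map {Q = λ i → _ ⊆ subgroup i}
      (λ {i} Gxs Px → All.lookupₛ setoid (IsSubgroup.respects (isSubgroup i)) Gxs (complete P-finite Px))
      (eventually-All (elements P-finite))

    module _ {S : Pred Carrier p} {T : Pred Carrier q} (S-resp : S Respects _≈_) (T-resp : T Respects _≈_) where

      ∩-resp : ∀ i → (S ∩ subgroup i) Respects _≈_
      ∩-resp i x≈y (Sx , Gx) = S-resp x≈y Sx , IsSubgroup.respects (isSubgroup i) x≈y Gx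

      card-∩-mono : ∀ i → S ⊆ T → ∣ S ∩G i ∣ ℕ.≤ ∣ T ∩G i ∣
      card-∩-mono i S⊆T = card-mono (∩-finite S-resp (finite i)) (∩-finite T-resp (finite i))
        (∩-resp i) λ (Sx , Gx) → S⊆T Sx , Gx

    Gᵢ≢0 : ∀ i → NonZero (card (finite i))
    Gᵢ≢0 i = card-nonZero (finite i) (0# , IsSubgroup.0-closed (isSubgroup i))

    card-∩-full : {S : Pred Carrier p} → S Respects _≈_ → (∀ x → S x) → ∀ i → ∣ S ∩G i ∣ ≡ card (finite i)
    card-∩-full S-resp S-full i = ℕ.≤-antisym
      (card-mono (∩-finite S-resp (finite i)) (finite i) (∩-resp S-resp S-resp i) proj₂)
      (card-mono (finite i) (∩-finite S-resp (finite i)) (IsSubgroup.respects (isSubgroup i)) λ Gx → S-full _ , Gx)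

    card-∩-≤ : {S : Pred Carrier p} → S Respects _≈_ → ∀ i → ∣ S ∩G i ∣ ℕ.≤ card (finite i)
    card-∩-≤ S-resp i = card-mono (∩-finite S-resp (finite i)) (finite i) (∩-resp S-resp S-resp i) proj₂

    card-∩-adjoin : ∀ {L : Pred Carrier p} → IsSubgroup G L → 2G G ⊆ L → ∀ {a i} → ¬ L a →
                    2G G ⊆ subgroup i → subgroup i a →
                    ∣ adjoin a L ∩G i ∣ ≡ 2 ℕ.* ∣ L ∩G i ∣
    card-∩-adjoin {L = L} L-sub 2G⊆L {a} {i} ¬La 2G⊆Gi Ga = ≡.trans
      (ℕ.≤-antisym
        (card-mono adjoin-∩ ∩-adjoin (∩-resp adjoin-resp adjoin-resp i) λ where
          (inj₁ Lx   , Gx) → inj₁ (Lx , Gx)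
          (inj₂ Lx+a , Gx) → inj₂ (Lx+a , IsSubgroup.+-closed (isSubgroup i) Gx Ga))
        (card-mono ∩-adjoin adjoin-∩
          (λ where
            x≈y (inj₁ x∈)   → inj₁ (L∩G-resp x≈y x∈)
            x≈y (inj₂ x+a∈) → inj₂ (L∩G-resp (∙-congʳ x≈y) x+a∈))
          λ where
          (inj₁ (Lx , Gx))     → inj₁ Lx , Gx
          (inj₂ (Lx+a , Gx+a)) → inj₂ Lx+a , +-cancelʳ-∈ (isSubgroup i) 2G⊆Gi Ga Gx+a))
      (card-adjoin a L∩G-resp disjoint (∩-finite L-resp (finite i)))
      where
      L-resp = IsSubgroup.respects L-sub
      adjoin-resp = IsSubgroup.respects (adjoin-isSubgroup L-sub 2G⊆L a)
      L∩G-resp = ∩-resp L-resp L-resp i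
      disjoint : ∀ {x} → (L ∩ subgroup i) x → ¬ (L ∩ subgroup i) (x + a)
      disjoint (Lx , _) (Lx+a , _) = ¬La (+-cancelˡ-∈ L-sub 2G⊆L Lx Lx+a)
      adjoin-∩ = ∩-finite adjoin-resp (finite i)
      ∩-adjoin = adjoin-finite a L∩G-resp disjoint (∩-finite L-resp (finite i))

    tower-card : Finite G (2G G) → ∀ {K : Pred Carrier p} {n L} → IsSubgroup G K → 2G G ⊆ K → Tower K n L →
                 Eventually (λ i → ∣ L ∩G i ∣ ≡ 2 ℕ.^ n ℕ.* ∣ K ∩G i ∣)
    tower-card _ K-sub 2G⊆K base = 0 , λ _ → ≡.sym (ℕ.+-identityʳ _)
    tower-card 2G-finite {n = suc n} K-sub 2G⊆K (step a ¬La T) = eventually-map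
      (λ (eq , 2G⊆Gi , Ga) → ≡.trans (card-∩-adjoin (tower-isSubgroup K-sub 2G⊆K T) (tower-2G 2G⊆K T) ¬La 2G⊆Gi Ga)
        (≡.trans (cong (2 ℕ.*_) eq) (≡.sym (ℕ.*-assoc 2 (2 ℕ.^ n) _))))
      (eventually-∩ (tower-card 2G-finite K-sub 2G⊆K T) (eventually-∩ (eventually-⊇ 2G-finite) (eventually-∈ a)))

    module _ (A : Pred Carrier p) (A-resp : A Respects _≈_) (2G-finite : Finite G (2G G)) where

      K = SubsetSums+2G A A-resp
      P = SubsetSums G A
      P-resp = subsetSums-resp A A-resp
      K-sub = K-isSubgroup A A-resp

      card-K∩-≤ : Eventually (λ i → ∣ K ∩G i ∣ ℕ.≤ ∣ P ∩G i ∣ ℕ.* card 2G-finite)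
      card-K∩-≤ = eventually-map {P = λ i → 2G G ⊆ subgroup i}
        (λ {i} 2G⊆Gi → card-sumset (∩-finite P-resp (finite i)) 2G-finite (∩-finite (K-resp A A-resp) (finite i))
          (∩-resp (K-resp A A-resp) (K-resp A A-resp) i)
          λ ((y , t , Py , 2Gt , x≈) , Gx) → y , t ,
            (Py , +-cancelʳ-∈ (isSubgroup i) 2G⊆Gi (2G⊆Gi 2Gt) (IsSubgroup.respects (isSubgroup i) x≈ Gx)) , 2Gt , x≈)
        (eventually-⊇ 2G-finite)

      density-≤ : ∀ {n L} → Tower K n L → Eventually (λ i → density em G• P i ℚ.≤ 2^- (fin n))
      density-≤ {n} T = eventually-map
        (λ {i} eq → /-mono-≤ {∣ P ∩G i ∣} {card (finite i)} {1} {2 ℕ.^ n} {{Gᵢ≢0 i}} {{ℕ.m^n≢0 2 n}} (begin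
          ∣ P ∩G i ∣ ℕ.* 2 ℕ.^ n  ≤⟨ ℕ.*-monoˡ-≤ (2 ℕ.^ n) (card-∩-mono P-resp (K-resp A A-resp) i (subsetSums⊆ A A-resp)) ⟩
          ∣ K ∩G i ∣ ℕ.* 2 ℕ.^ n  ≡⟨ ℕ.*-comm ∣ K ∩G i ∣ _ ⟩
          2 ℕ.^ n ℕ.* ∣ K ∩G i ∣  ≡⟨ eq ⟨
          ∣ _ ∩G i ∣              ≤⟨ card-∩-≤ (IsSubgroup.respects (tower-isSubgroup K-sub (2G⊆K A A-resp) T)) i ⟩
          card (finite i)         ≡⟨ ℕ.+-identityʳ _ ⟨
          1 ℕ.* card (finite i)   ∎))
        (tower-card 2G-finite K-sub (2G⊆K A A-resp) T)
        where open ℕ.≤-Reasoning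

      density-≥ : ∀ {n L} → Tower K n L → (∀ x → L x) →
                  Eventually (λ i → 2^- (fin n) * reciprocalCard2G 2G-finite ℚ.≤ density em G• P i)
      density-≥ {n} T full = eventually-map
        (λ {i} (eq , le) → subst (ℚ._≤ density em G• P i) (≡.sym (1/-* (2 ℕ.^ n) g {{ℕ.m^n≢0 2 n}} {{g≢0}}))
          (/-mono-≤ {1} {2 ℕ.^ n ℕ.* g} {∣ P ∩G i ∣} {card (finite i)}
            {{ℕ.m*n≢0 (2 ℕ.^ n) g {{ℕ.m^n≢0 2 n}} {{g≢0}}}} {{Gᵢ≢0 i}} (begin
          1 ℕ.* card (finite i)             ≡⟨ ℕ.+-identityʳ _ ⟩
          card (finite i)                   ≡⟨ card-∩-full (IsSubgroup.respects (tower-isSubgroup K-sub (2G⊆K A A-resp) T)) full i ⟨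
          ∣ _ ∩G i ∣                        ≡⟨ eq ⟩
          2 ℕ.^ n ℕ.* ∣ K ∩G i ∣            ≤⟨ ℕ.*-monoʳ-≤ (2 ℕ.^ n) le ⟩
          2 ℕ.^ n ℕ.* (∣ P ∩G i ∣ ℕ.* g)    ≡⟨ x∙yz≈y∙xz (2 ℕ.^ n) ∣ P ∩G i ∣ g ⟩
          ∣ P ∩G i ∣ ℕ.* (2 ℕ.^ n ℕ.* g)    ∎)))
        (eventually-∩ (tower-card 2G-finite K-sub (2G⊆K A A-resp) T) card-K∩-≤)
        where
        open ℕ.≤-Reasoning
        open CommutativeSemigroupProperties ℕ.*-commutativeSemigroup using (x∙yz≈y∙xz)
        g = card 2G-finite
        g≢0 = card-nonZero 2G-finite (0# , 0# , sym (identityˡ 0#))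

      0≤density : ∀ i → 0ℚ ℚ.≤ density em G• P i
      0≤density i = /-mono-≤ {0} {1} {∣ P ∩G i ∣} {card (finite i)} {{_}} {{Gᵢ≢0 i}} ℕ.z≤n

      DensityBounds : ℕ ⁺ → Set
      DensityBounds m =
          fromℚ (2^- m * reciprocalCard2G 2G-finite) ≤ʳ lowerDensity em G• P
        × upperDensity em G• P ≤ʳ fromℚ (2^- m)

      density-bounds-fin : ∀ {n L} → Tower K n L → (∀ x → L x) → DensityBounds (fin n)
      density-bounds-fin {n} T full =
        liminf-≥ (density-≥ T full) , limsup-≤ (density-≤ T)

      density-bounds-∞ : (∀ n → ∃ λ L → Tower K n L) → DensityBounds ⊤⁺
      density-bounds-∞ towers =
        liminf-≥
          (0 , λ {i} _ → subst (ℚ._≤ density em G• P i) (≡.sym (ℚ.*-zeroˡ (reciprocalCard2G 2G-finite))) (0≤density i)) ,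
        limsup-≤0 (λ n → density-≤ (proj₂ (towers n)))

      density-bounds : ∃ DensityBounds
      density-bounds =
        [ (λ (n , L , T , full) → fin n , density-bounds-fin T full) , (λ towers → ⊤⁺ , density-bounds-∞ towers) ]′
          (tower-exhaustive-or-unbounded K)

½<2^-⇒0 : ∀ {m q} → ½ ℚ.≤ q → q ℚ.< 2^- m → m ≡ fin 0
½<2^-⇒0 {fin zero}    _   _   = refl
½<2^-⇒0 {fin (suc n)} ½≤q q<2^-m = contradiction (ℚ.<-≤-trans (ℚ.≤-<-trans ½≤q q<2^-m) 2^-m≤½) (ℚ.<-irrefl refl)
  where
  2^-m≤½ : 2^- (fin (suc n)) ℚ.≤ ½
  2^-m≤½ = /-mono-≤ {1} {2 ℕ.^ suc n} {1} {2} {{ℕ.m^n≢0 2 (suc n)}}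
    (subst (2 ℕ.≤_) (≡.sym (ℕ.+-identityʳ _)) (ℕ.*-monoʳ-≤ 2 (ℕ.m^n>0 2 n)))
½<2^-⇒0 {⊤⁺} ½≤q q<0 = contradiction (ℚ.≤-<-trans ½≤q q<0) λ { (ℚ.*<* (ℤ.+<+ ())) }

>½⇒≥ : ∀ m {x y ρ} → fromℚ (2^- m * ρ) ≤ʳ x → y ≤ʳ fromℚ (2^- m) → fromℚ ½ <ʳ y → fromℚ ρ ≤ʳ x
>½⇒≥ m {ρ = ρ} lo up (q , q≮½ , q<y) {r} r<ρ with refl ← ½<2^-⇒0 {m} {q} (ℚ.≮⇒≥ q≮½) (up {q} q<y) =
  lo {r} (subst (r ℚ.<_) (≡.sym (ℚ.*-identityˡ ρ)) r<ρ)

theorem1p4 : (em : Classical) →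
    ∀ {c ℓ p s : Level} (G : AbelianGroup c ℓ) →
    Countable G →
    LocallyFinite G →
    (2G-finite : Finite G (2G G)) →
    (G• : Filtration G s) →
    (A : Pred (AbelianGroup.Carrier G) p) → A Respects (AbelianGroup._≈_ G) →
    (∃ λ (m : ℕ ⁺) →
    fromℚ (2^- m * reciprocalCard2G 2G-finite) ≤ʳ lowerDensity em G• (SubsetSums G A)
    × lowerDensity em G• (SubsetSums G A) ≤ʳ upperDensity em G• (SubsetSums G A)
    × upperDensity em G• (SubsetSums G A) ≤ʳ fromℚ (2^- m))
    × (fromℚ ½ <ʳ upperDensity em G• (SubsetSums G A) →
    fromℚ (reciprocalCard2G 2G-finite) ≤ʳ lowerDensity em G• (SubsetSums G A))
theorem1p4 em G _ _ 2G-finite G• A A-resp =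
  let m , lo , up = density-bounds em G G• A A-resp 2G-finite in
  (m , lo , liminf≤limsup (λ i → fromℚ (density em G• (SubsetSums G A) i)) , up) ,
  >½⇒≥ m {lowerDensity em G• (SubsetSums G A)} {upperDensity em G• (SubsetSums G A)} lo up
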